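{- For every positive integer $n$, the lion number of the triangular grid graph $T_n$ satisfies \[ \frac{n}{2\sqrt{2}}<l(T_n)\le n+1 . \]
   Context: The triangular grid graph $T_n$ has vertex set $\{(v_1,v_2)\in\mathbb{Z}_{\ge 0}^2 : v_1+v_2\le n\}$, and two vertices are adjacent iff they are of the form $(a,b),(a+1,b)$, or $(a,b),(a,b+1)$, or $(a+1,b),(a,b+1)$. Lions and Contamination game on a graph $G$ with $\ell$ lions: the lions are placed on vertices; initially every vertex not occupied by a lion is contaminated. In each turn every lion simultaneously either stays at its vertex or moves along an edge to an adjacent vertex, and simultaneously the contamination spreads: after the turn, a vertex $v$ is contaminated iff $v$ is not occupied by a lion after the turn and either $v$ was contaminated before the turn, or $v$ has a neighbor $u$ that was contaminated before the turn such that no lion traversed the edge $uv$ during this turn. (Thus contamination moves along edges, cannot pass through an edge used by a lion in that turn, and may recontaminate previously cleared vertices.) A winning strategy is a finite sequence of lion moves after which no vertex is contaminated. The lion number $l(G)$ is the minimum number of lions for which a winning strategy exists. -}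

module Defs where

open import Data.Nat using (ℕ; suc; _+_; _≤_)
open import Data.Fin using (Fin)
open import Data.Product using (Σ; ∃; _×_; _,_; proj₁; proj₂)
open import Data.Sum using (_⊎_)
open import Data.List using (List; []; _∷_)
open import Data.Unit using (⊤)
open import Relation.Nullary using (¬_)
open import Relation.Binary.PropositionalEquality using (_≡_)

record Graph : Set₁ where
  field
    V   : Set
    Adj : V → V → Set

module _ (G : Graph) where
  open Graph G

  -- positions of ℓ lions (several lions may share a vertex)
  Config : ℕ → Set
  Config ℓ = Fin ℓ → V

  Occupied : ∀ {ℓ} → Config ℓ → V → Set
  Occupied p v = ∃ λ i → p i ≡ v

  Traversed : ∀ {ℓ} → Config ℓ → Config ℓ → V → V → Set
  Traversed p p' u v = ∃ λ i → (p i ≡ u × p' i ≡ v) ⊎ (p i ≡ v × p' i ≡ u)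

  ValidMove : ∀ {ℓ} → Config ℓ → Config ℓ → Set
  ValidMove p p' = ∀ i → p' i ≡ p i ⊎ Adj (p i) (p' i)

  Step : ∀ {ℓ} → Config ℓ → Config ℓ → (V → Set) → V → Set
  Step p p' C v =
    ¬ Occupied p' v ×
    (C v ⊎ ∃ λ u → Adj u v × C u × ¬ Traversed p p' u v)

  InitialContamination : ∀ {ℓ} → Config ℓ → V → Set
  InitialContamination p v = ¬ Occupied p v

  ValidPlay : ∀ {ℓ} → Config ℓ → List (Config ℓ) → Set
  ValidPlay p []         = ⊤
  ValidPlay p (p' ∷ ps)  = ValidMove p p' × ValidPlay p' ps

  Contamination : ∀ {ℓ} → Config ℓ → (V → Set) → List (Config ℓ) → V → Set
  Contamination p C []        = C
  Contamination p C (p' ∷ ps) = Contamination p' (Step p p' C) ps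

  LionsWin : ℕ → Set
  LionsWin ℓ = Σ (Config ℓ) λ p₀ → Σ (List (Config ℓ)) λ moves →
    ValidPlay p₀ moves ×
    (∀ v → ¬ Contamination p₀ (InitialContamination p₀) moves v)

  IsLionNumber : ℕ → Set
  IsLionNumber k = LionsWin k × (∀ ℓ → LionsWin ℓ → k ≤ ℓ)

TVertex : ℕ → Set
TVertex n = Σ (ℕ × ℕ) λ q → proj₁ q + proj₂ q ≤ n

-- one orientation of the three edge types
TEdge : ∀ {n} → TVertex n → TVertex n → Set
TEdge ((a , b) , _) ((c , d) , _) =
  (c ≡ suc a × d ≡ b) ⊎ (c ≡ a × d ≡ suc b) ⊎ (a ≡ suc c × d ≡ suc b)

T : ℕ → Graph
T n = record { V = TVertex n ; Adj = λ u v → TEdge u v ⊎ TEdge v u }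

{-# OPTIONS --safe #-}

-- Upper bound: one lion per row sweeps from left to right, the rows being staggered so that no
-- contamination slips back.
--
-- Lower bound: if S is the clear set and J its interior (clear vertices with only clear neighbours), then a
-- clear vertex after the turn that no lion touches before or after the turn lies in J.  So with ℓ lions
-- |S'| ≤ |J| + 2ℓ, and S grows only while its inner boundary has fewer than 2ℓ vertices.  A column-by-column
-- isoperimetric inequality shows that a set with C boundary vertices, or its complement, has at most
-- C (C + 1) / 2 vertices.  When 8ℓ² ≤ n², this keeps 2|S| ≤ (2ℓ)² forever.
--
-- The least winning number exists constructively because the pairs of a configuration and a
-- contaminated set form a finite state space, on which reachability is decidable.

module Submission where

open import Defs
open import Data.Bool using (Bool; true; false; if_then_else_; _∧_; T?) renaming (T to IsTrue)
import Data.Bool.Properties as Bool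
open import Data.Fin using (Fin; zero; suc; toℕ; fromℕ<)
import Data.Fin.Properties as Fin
open import Data.List using (List; []; _∷_; length; filter; concatMap; cartesianProduct; cartesianProductWith; upTo)
import Data.List as List
open import Data.List.Membership.Propositional using (_∈_; lose)
open import Data.List.Membership.Propositional.Properties
  using (∈-filter⁺; ∈-cartesianProductWith⁺; ∈-cartesianProduct⁺; ∈-concatMap⁺; ∈-upTo⁺)
open import Data.List.Properties using (filter-notAll)
open import Data.List.Relation.Unary.All as All using (all?)
open import Data.List.Relation.Unary.All.Properties using (¬All⇒Any¬)
open import Data.List.Relation.Unary.Any using (Any; here; there; any?; satisfied; index)
open import Data.List.Relation.Unary.Any.Properties using (lookup-index)
open import Data.Nat using (ℕ; zero; suc; _+_; _*_; _∸_; _⊓_; ⌊_/2⌋; _≤_; _<_; z≤n; s≤s; s≤s⁻¹; _≤?_; _<?_; _≟_; _≡ᵇ_)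
open import Data.Nat.Induction using (<-wellFounded)
open import Data.Nat.Properties hiding (_≤?_; _<?_; _≟_)
open import Algebra.Properties.CommutativeSemigroup +-commutativeSemigroup using (interchange)
open import Data.Nat.Tactic.RingSolver using (solve-∀)
open import Data.Product using (Σ; ∃; _×_; _,_; proj₁; proj₂)
open import Data.Product.Properties using (≡-dec)
open import Data.Sum using (_⊎_; inj₁; inj₂; [_,_]′)
open import Data.Unit using (tt)
open import Data.Vec using (Vec; []; _∷_; lookup; tabulate)
open import Data.Vec.Properties using (lookup∘tabulate) renaming (≡-dec to Vec-≡-dec)
open import Function using (_∘_; _⇔_; mk⇔; Equivalence)
open import Induction.WellFounded using (Acc; acc)
open import Relation.Binary.Definitions using (DecidableEquality)
open import Relation.Binary.PropositionalEquality using (_≡_; refl; sym; trans; cong; cong₂; subst; subst₂; _≗_)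
open import Relation.Nullary using (¬_; Dec; yes; no; contradiction)
open import Relation.Nullary.Decidable using (map′; _×-dec_; _⊎-dec_; _→-dec_; ¬?; toWitness; fromWitness; ⌊_⌋)
open import Relation.Unary using (Decidable)

-- Decidability of winning

data Reach {St : Set} (Goal : St → Set) (Next : St → St → Set) (s : St) : Set where
  done : Goal s → Reach Goal Next s
  step : ∀ {t} → Next s t → Reach Goal Next t → Reach Goal Next s

module Reachability {St : Set} (sts : List St) (complete : ∀ s → s ∈ sts)
  {Goal : St → Set} (goal? : Decidable Goal)
  {Next : St → St → Set} (next? : ∀ s t → Dec (Next s t)) where

  Within : ℕ → St → Set
  Within zero    s = Goal s
  Within (suc k) s = Within k s ⊎ ∃ λ t → Next s t × Within k t

  within? : ∀ k → Decidable (Within k)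
  within? zero    s = goal? s
  within? (suc k) s = within? k s ⊎-dec
    map′ satisfied (λ (t , p) → lose (complete t) p)
      (any? (λ t → next? s t ×-dec within? k t) sts)

  Stable : ℕ → Set
  Stable k = ∀ s → Within (suc k) s → Within k s

  -- While the sets Within k grow, the list of states that are still missing shrinks.
  stabilises : ∃ Stable
  stabilises = go sts (<-wellFounded _) 0 (λ s → inj₂ (complete s))
    where
    go : ∀ xs → Acc _<_ (length xs) → ∀ k → (∀ s → Within k s ⊎ s ∈ xs) → ∃ Stable
    go xs (acc rec) k cover
      with all? (λ s → within? (suc k) s →-dec within? k s) sts
    ... | yes all = k , λ s → All.lookup all (complete s)
    ... | no ¬all = go (filter new? xs) (rec (filter-notAll new? xs some)) (suc k) cover′
      where
      new? : Decidable (λ s → ¬ Within (suc k) s)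
      new? s = ¬? (within? (suc k) s)
      fresh : ∃ λ s → ¬ (Within (suc k) s → Within k s)
      fresh = satisfied (¬All⇒Any¬ (λ s → within? (suc k) s →-dec within? k s) sts ¬all)
      some : Any (λ s → ¬ ¬ Within (suc k) s) xs
      some with fresh
      ... | s , f with cover s
      ...   | inj₁ w    = contradiction (λ _ → w) f
      ...   | inj₂ s∈xs = lose s∈xs λ ¬w → f λ w → contradiction w ¬w
      cover′ : ∀ s → Within (suc k) s ⊎ s ∈ filter new? xs
      cover′ s with within? (suc k) s | cover s
      ... | yes w | _         = inj₁ w
      ... | no ¬w | inj₁ w    = contradiction (inj₁ w) ¬w
      ... | no ¬w | inj₂ s∈xs = inj₂ (∈-filter⁺ new? s∈xs ¬w)

  Within⇒Reach : ∀ k {s} → Within k s → Reach Goal Next s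
  Within⇒Reach zero    g                    = done g
  Within⇒Reach (suc k) (inj₁ w)             = Within⇒Reach k w
  Within⇒Reach (suc k) (inj₂ (t , s→t , w)) = step s→t (Within⇒Reach k w)

  Goal⇒Within : ∀ k {s} → Goal s → Within k s
  Goal⇒Within zero    g = g
  Goal⇒Within (suc k) g = inj₁ (Goal⇒Within k g)

  -- Stability absorbs each step put in front of a path, so paths of every length fit into
  -- `Within k`.
  Reach⇒Within : ∀ k → Stable k → ∀ {s} → Reach Goal Next s → Within k s
  Reach⇒Within k st (done g)         = Goal⇒Within k g
  Reach⇒Within k st {s} (step s→t r) = st s (inj₂ (_ , s→t , Reach⇒Within k st r))

  reach? : Decidable (Reach Goal Next)
  reach? s with stabilises
  ... | k , st = map′ (Within⇒Reach k) (Reach⇒Within k st) (within? k s)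

vectors : ∀ {A : Set} → List A → ∀ k → List (Vec A k)
vectors xs zero    = [] ∷ []
vectors xs (suc k) = cartesianProductWith _∷_ xs (vectors xs k)

∈-vectors : ∀ {A : Set} {xs : List A} → (∀ x → x ∈ xs) → ∀ {k} (v : Vec A k) → v ∈ vectors xs k
∈-vectors all []      = here refl
∈-vectors all (x ∷ v) = ∈-cartesianProductWith⁺ _∷_ (all x) (∈-vectors all v)

∈-Bool : ∀ b → b ∈ (true ∷ false ∷ [])
∈-Bool true  = here refl
∈-Bool false = there (here refl)

-- The game on a finite graph as a finite state space

module _ (G : Graph) where
  open Graph G

  -- Configurations are functions and contaminated sets are predicates, so neither can be listed.
  -- This lemma lets vectors and markings stand in for them without function extensionality.
  Step-resp : ∀ {ℓ} {p p' q q' : Config G ℓ} {C D : V → Set} →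
    p ≗ q → p' ≗ q' → (∀ v → C v → D v) → ∀ v → Step G p p' C v → Step G q q' D v
  Step-resp {p = p} {p'} {q} {q'} {C} {D} e e' C⊆D v (¬occ , c) = occ , [ inj₁ ∘ C⊆D v , inj₂ ∘ spread ]′ c
    where
    occ : ¬ Occupied G q' v
    occ (i , x) = ¬occ (i , trans (e' i) x)
    spread : (∃ λ u → Adj u v × C u × ¬ Traversed G p p' u v) →
             (∃ λ u → Adj u v × D u × ¬ Traversed G q q' u v)
    spread (u , adj , cu , ¬tr) = u , adj , C⊆D u cu , λ where
      (i , inj₁ (x , y)) → ¬tr (i , inj₁ (trans (e i) x , trans (e' i) y))
      (i , inj₂ (x , y)) → ¬tr (i , inj₂ (trans (e i) x , trans (e' i) y))

  WinningFrom : ∀ {ℓ} → Config G ℓ → (V → Set) → Set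
  WinningFrom p C = Σ (List _) λ moves →
    ValidPlay G p moves × (∀ v → ¬ Contamination G p C moves v)

module FiniteGraph (G : Graph) (_≟ⱽ_ : DecidableEquality (Graph.V G))
  (adj? : ∀ u v → Dec (Graph.Adj G u v)) (vs : List (Graph.V G)) (complete : ∀ v → v ∈ vs) where

  open Graph G

  ∃? : ∀ {P : V → Set} → Decidable P → Dec (∃ P)
  ∃? P? = map′ satisfied (λ (v , p) → lose (complete v) p) (any? P? vs)

  ∀? : ∀ {P : V → Set} → Decidable P → Dec (∀ v → P v)
  ∀? P? = map′ (λ all v → All.lookup all (complete v)) (λ f → All.tabulate λ {v} _ → f v) (all? P? vs)

  module _ {ℓ : ℕ} where

    occupied? : (p : Config G ℓ) → Decidable (Occupied G p)
    occupied? p v = Fin.any? λ i → p i ≟ⱽ v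

    traversed? : (p p' : Config G ℓ) → ∀ u v → Dec (Traversed G p p' u v)
    traversed? p p' u v = Fin.any? λ i →
      ((p i ≟ⱽ u) ×-dec (p' i ≟ⱽ v)) ⊎-dec ((p i ≟ⱽ v) ×-dec (p' i ≟ⱽ u))

    validMove? : (p p' : Config G ℓ) → Dec (ValidMove G p p')
    validMove? p p' = Fin.all? λ i → (p' i ≟ⱽ p i) ⊎-dec adj? (p i) (p' i)

    initial? : (p : Config G ℓ) → Decidable (InitialContamination G p)
    initial? p v = ¬? (occupied? p v)

    step? : (p p' : Config G ℓ) → ∀ {C} → Decidable C → Decidable (Step G p p' C)
    step? p p' C? v = ¬? (occupied? p' v) ×-dec
      (C? v ⊎-dec ∃? λ u → adj? u v ×-dec (C? u ×-dec ¬? (traversed? p p' u v)))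

  -- A Boolean vector is a contaminated set with decidable equality, from a finite list. Only the
  -- position at which `complete` finds a vertex is read, so repetitions in `vs` do no harm.
  Marking : Set
  Marking = Vec Bool (length vs)

  Marked : Marking → V → Set
  Marked m v = IsTrue (lookup m (index (complete v)))

  marked? : ∀ m → Decidable (Marked m)
  marked? m v = T? _

  mark : ∀ {C : V → Set} → Decidable C → Marking
  mark C? = tabulate λ j → ⌊ C? (List.lookup vs j) ⌋

  Marked-mark : ∀ {C : V → Set} (C? : Decidable C) → ∀ v → C v ⇔ Marked (mark C?) v
  Marked-mark {C} C? v = mk⇔
      (λ c → subst IsTrue (sym eq) (fromWitness (subst C v≡ c)))
      (λ t → subst C (sym v≡) (toWitness (subst IsTrue eq t)))
    where
    j  = index (complete v)
    v≡ : v ≡ List.lookup vs j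
    v≡ = lookup-index (complete v)
    eq : lookup (mark C?) j ≡ ⌊ C? (List.lookup vs j) ⌋
    eq = lookup∘tabulate _ j

  module _ (ℓ : ℕ) where

    State : Set
    State = Vec V ℓ × Marking

    Goal : State → Set
    Goal (_ , m) = ∀ v → ¬ Marked m v

    next : Vec V ℓ → Vec V ℓ → Marking → Marking
    next p p' m = mark (step? (lookup p) (lookup p') (marked? m))

    Next : State → State → Set
    Next (p , m) (p' , m') = ValidMove G (lookup p) (lookup p') × m' ≡ next p p' m

    Encodes : Marking → (V → Set) → Set
    Encodes m C = ∀ v → C v ⇔ Marked m v

    next-encodes : ∀ {p p' : Config G ℓ} q q' m {C} → p ≗ lookup q → p' ≗ lookup q' →
      Encodes m C → Encodes (next q q' m) (Step G p p' C)
    next-encodes q q' m e e' enc v = mk⇔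
        (to ∘ Step-resp G e e' (λ u → Equivalence.to (enc u)) v)
        (Step-resp G (sym ∘ e) (sym ∘ e') (λ u → Equivalence.from (enc u)) v ∘ from)
      where open Equivalence (Marked-mark (step? (lookup q) (lookup q') (marked? m)) v)

    -- The play is followed with every configuration tabulated. Allowing any `p` with `p ≗ lookup q`
    -- lets the recursion continue from `tabulate p'`, while `Encodes` ties the marking to the true
    -- contamination.
    win⇒reach : ∀ {p : Config G ℓ} {q m C} → p ≗ lookup q → Encodes m C →
      WinningFrom G p C → Reach Goal Next (q , m)
    win⇒reach e enc ([] , _ , clear) = done λ v → clear v ∘ Equivalence.from (enc v)
    win⇒reach {p} {q} {m} {C} e enc (p' ∷ ps , (valid , play) , clear) =
      step {t = tabulate p' , next q (tabulate p') m} (valid′ , refl)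
        (win⇒reach {p'} {tabulate p'} {next q (tabulate p') m} {Step G p p' C}
          e' (next-encodes q (tabulate p') m e e' enc) (ps , play , clear))
      where
      e' : p' ≗ lookup (tabulate p')
      e' i = sym (lookup∘tabulate p' i)
      valid′ : ValidMove G (lookup q) (lookup (tabulate p'))
      valid′ i = subst₂ (λ u u' → u' ≡ u ⊎ Adj u u') (e i) (e' i) (valid i)

    reach⇒win : ∀ {q m C} → Encodes m C → Reach Goal Next (q , m) → WinningFrom G (lookup q) C
    reach⇒win enc (done g) = [] , tt , λ v → g v ∘ Equivalence.to (enc v)
    reach⇒win {q} {m} {C} enc (step {q' , _} (valid , refl) r) =
      let ps , play , clear = reach⇒win {q'} {next q q' m} {Step G (lookup q) (lookup q') C}
                                (next-encodes q q' m (λ _ → refl) (λ _ → refl) enc) r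
      in lookup q' ∷ ps , (valid , play) , clear

    start : Vec V ℓ → State
    start q = q , mark (initial? (lookup q))

    open Reachability (cartesianProduct (vectors vs ℓ) (vectors (true ∷ false ∷ []) (length vs)))
      (λ (p , m) → ∈-cartesianProduct⁺ (∈-vectors complete p) (∈-vectors ∈-Bool m))
      {Goal} (λ (_ , m) → ∀? λ v → ¬? (marked? m v))
      {Next} (λ (p , m) (p' , m') → validMove? (lookup p) (lookup p') ×-dec Vec-≡-dec Bool._≟_ m' (next p p' m))

    lionsWin? : Dec (LionsWin G ℓ)
    lionsWin? = map′ to from (any? (reach? ∘ start) (vectors vs ℓ))
      where
      to : Any _ (vectors vs ℓ) → LionsWin G ℓ
      to r =
        let q , r′ = satisfied r
            init?  = initial? (lookup q)
        in lookup q , reach⇒win {m = mark init?} (Marked-mark init?) r′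
      from : LionsWin G ℓ → Any _ (vectors vs ℓ)
      from (p , win) = lose (∈-vectors complete (tabulate p)) (win⇒reach e enc win)
        where
        e : p ≗ lookup (tabulate p)
        e i = sym (lookup∘tabulate p i)
        occ : ∀ v → InitialContamination G p v ⇔ InitialContamination G (lookup (tabulate p)) v
        occ v = mk⇔ (λ ¬o (i , x) → ¬o (i , trans (e i) x)) (λ ¬o (i , x) → ¬o (i , trans (sym (e i)) x))
        init? : Decidable (InitialContamination G (lookup (tabulate p)))
        init? = initial? (lookup (tabulate p))
        enc : Encodes (mark init?) (InitialContamination G p)
        enc v = mk⇔ (Equivalence.to (Marked-mark init? v) ∘ Equivalence.to (occ v))
                    (Equivalence.from (occ v) ∘ Equivalence.from (Marked-mark init? v))

-- The search runs upwards from 0 and the known witness `m` makes it end. The clause `k ≤ m` later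
-- carries the upper bound over to the lion number.
least : ∀ {P : ℕ → Set} → Decidable P → ∀ m → P m → ∃ λ k → P k × (∀ l → P l → k ≤ l) × k ≤ m
least P? m pm with P? 0
... | yes p0 = 0 , p0 , (λ _ _ → z≤n) , z≤n
least P? zero    pm | no ¬p0 = contradiction pm ¬p0
least {P} P? (suc m) pm | no ¬p0 with least (P? ∘ suc) m pm
... | k , pk , min , k≤m = suc k , pk , min′ , s≤s k≤m
  where
  min′ : ∀ l → P l → suc k ≤ l
  min′ zero    p = contradiction p ¬p0
  min′ (suc l) p = s≤s (min l p)

-- The finitely many vertices of the triangle

infix 4 _≟ᵀ_
TVertex-≡ : ∀ {n} {u v : TVertex n} → proj₁ u ≡ proj₁ v → u ≡ v
TVertex-≡ {u = q , le} {.q , le′} refl = cong (q ,_) (≤-irrelevant le le′)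

_≟ᵀ_ : ∀ {n} → DecidableEquality (TVertex n)
u ≟ᵀ v = map′ TVertex-≡ (cong proj₁) (≡-dec _≟_ _≟_ (proj₁ u) (proj₁ v))

TEdge? : ∀ {n} (u v : TVertex n) → Dec (TEdge u v)
TEdge? ((a , b) , _) ((c , d) , _) =
  ((c ≟ suc a) ×-dec (d ≟ b)) ⊎-dec (((c ≟ a) ×-dec (d ≟ suc b)) ⊎-dec ((a ≟ suc c) ×-dec (d ≟ suc b)))

fromDec : ∀ {A : Set} → Dec A → List A
fromDec (yes a) = a ∷ []
fromDec (no _)  = []

verticesAt : ∀ n → ℕ × ℕ → List (TVertex n)
verticesAt n q = List.map (q ,_) (fromDec (proj₁ q + proj₂ q ≤? n))

vertices : ∀ n → List (TVertex n)
vertices n = concatMap (verticesAt n) (cartesianProduct (upTo (suc n)) (upTo (suc n)))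

∈-vertices : ∀ {n} (v : TVertex n) → v ∈ vertices n
∈-vertices {n} ((a , b) , le) = ∈-concatMap⁺ (verticesAt n) (lose
    (∈-cartesianProduct⁺ (∈-upTo⁺ (s≤s (≤-trans (m≤m+n a b) le))) (∈-upTo⁺ (s≤s (≤-trans (m≤n+m b a) le))))
    (found (a + b ≤? n)))
  where
  found : (le? : Dec (a + b ≤ n)) → ((a , b) , le) ∈ List.map ((a , b) ,_) (fromDec le?)
  found (yes le′) = here (TVertex-≡ refl)
  found (no ¬le)  = contradiction le ¬le

module _ {n : ℕ} where
  open FiniteGraph (T n) _≟ᵀ_ (λ u v → TEdge? u v ⊎-dec TEdge? v u) (vertices n) ∈-vertices public

-- The sweeping strategy

∸-suc-≤ : ∀ m n → m ∸ n ≤ suc (m ∸ suc n)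
∸-suc-≤ zero    zero    = z≤n
∸-suc-≤ zero    (suc n) = z≤n
∸-suc-≤ (suc m) zero    = ≤-refl
∸-suc-≤ (suc m) (suc n) = ∸-suc-≤ m n

module Sweep (n : ℕ) where

  -- The lion of row b starts at time b and then moves right in every second turn, so
  -- each row is never ahead of, and at most one step behind, the row before it.
  front : ℕ → ℕ → ℕ
  front t b = (n ∸ b) ⊓ ⌊ t ∸ b /2⌋

  front-mono : ∀ t b → front t b ≤ front (suc t) b
  front-mono t b = ⊓-monoʳ-≤ (n ∸ b) (⌊n/2⌋-mono (∸-monoˡ-≤ b (n≤1+n t)))

  front-speed : ∀ t b → front (suc t) b ≤ suc (front t b)
  front-speed t b = ⊓-mono-≤ (n≤1+n (n ∸ b))
    (⌊n/2⌋-mono (≤-trans (∸-suc-≤ (suc t) b) (n≤1+n _)))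

  -- The later start of the next row cancels the extra turn: `suc t ∸ suc b` is `t ∸ b`.
  front-above : ∀ t b → front (suc t) (suc b) ≤ front t b
  front-above t b = ⊓-monoˡ-≤ ⌊ t ∸ b /2⌋ (∸-monoʳ-≤ n (n≤1+n b))

  -- The time `suc t ∸ b` exceeds `t ∸ suc b` by at most two, which halving turns into one.
  front-below : ∀ t b → front (suc t) b ≤ suc (front t (suc b))
  front-below t b = ⊓-mono-≤ (∸-suc-≤ n b)
    (⌊n/2⌋-mono (≤-trans (∸-suc-≤ (suc t) b) (s≤s (∸-suc-≤ t b))))

  position : ℕ → Config (T n) (n + 1)
  position t i = (front t b , b) , ≤-trans (+-monoˡ-≤ b (m⊓n≤m _ _)) (≤-reflexive (m∸n+n≡m b≤n))
    where
    b = toℕ i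
    b≤n : b ≤ n
    b≤n = ≤-pred (subst (b <_) (+-comm n 1) (Fin.toℕ<n i))

  lion-in-row : ∀ b → b ≤ n → ∃ λ i → ∀ t → proj₁ (position t i) ≡ (front t b , b)
  lion-in-row b b≤n = fromℕ< b< , λ t → cong (λ c → front t c , c) (Fin.toℕ-fromℕ< b<)
    where
    b< : b < n + 1
    b< = subst (b <_) (+-comm 1 n) (s≤s b≤n)

  position-valid : ∀ t → ValidMove (T n) (position t) (position (suc t))
  position-valid t i with front t (toℕ i) <? front (suc t) (toℕ i)
  ... | yes lt = inj₂ (inj₁ (inj₁ (≤-antisym (front-speed t (toℕ i)) lt , refl)))
  ... | no ¬lt = inj₁ (TVertex-≡ (cong (_, toℕ i) (≤-antisym (≮⇒≥ ¬lt) (front-mono t (toℕ i)))))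

  Ahead : ℕ → (TVertex n → Set) → Set
  Ahead t C = ∀ v → C v → front t (proj₂ (proj₁ v)) < proj₁ (proj₁ v)

  -- A violating vertex is unoccupied, hence strictly behind the new position of its lion. Then its
  -- left neighbour and, by `front-above` and `front-below`, its neighbours in the adjacent rows
  -- were at or behind the old front, so they were clear.
  step-ahead : ∀ t {C} → Ahead t C → Ahead (suc t) (Step (T n) (position t) (position (suc t)) C)
  step-ahead t {C} ahead v@((a , b) , le) (¬occ , c) with front (suc t) b <? a
  ... | yes lt = lt
  ... | no ¬lt = contradiction c [ old , spread ]′
    where
    lion = lion-in-row b (≤-trans (m≤n+m b a) le)
    i = proj₁ lion
    behind : a < front (suc t) b
    behind = ≤∧≢⇒< (≮⇒≥ ¬lt) λ a≡ → ¬occ (i , TVertex-≡ (trans (proj₂ lion (suc t)) (cong (_, b) (sym a≡))))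
    a≤front : a ≤ front t b
    a≤front = ≤-pred (≤-trans behind (front-speed t b))
    old : ¬ C v
    old cv = <⇒≱ (ahead v cv) a≤front
    spread : ¬ (∃ λ u → (TEdge u v ⊎ TEdge v u) × C u × ¬ Traversed (T n) (position t) (position (suc t)) u v)
    spread (u@((a' , b') , _) , inj₁ (inj₁ (refl , refl)) , cu , _) =
      <⇒≱ (ahead u cu) (≤-trans (n≤1+n a') a≤front)
    spread (u@((a' , b') , _) , inj₁ (inj₂ (inj₁ (refl , refl))) , cu , _) =
      <⇒≱ (ahead u cu) (≤-trans (<⇒≤ behind) (front-above t b'))
    spread (u@((a' , b') , _) , inj₁ (inj₂ (inj₂ (refl , refl))) , cu , _) =
      <⇒≱ (ahead u cu) (≤-trans behind (front-above t b'))
    -- The right neighbour can be contaminated only if the lion stood on `v`. It has then just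
    -- walked along this very edge and blocked it.
    spread (u@((a' , b') , _) , inj₂ (inj₁ (refl , refl)) , cu , ¬tr) =
      ¬tr (i , inj₂ (TVertex-≡ (trans (proj₂ lion t) (cong (_, b) now)) ,
                     TVertex-≡ (trans (proj₂ lion (suc t)) (cong (_, b) later))))
      where
      now : front t b ≡ a
      now = ≤-antisym (≤-pred (ahead u cu)) a≤front
      later : front (suc t) b ≡ suc a
      later = ≤-antisym (subst (λ x → front (suc t) b ≤ suc x) now (front-speed t b)) behind
    spread (u@((a' , b') , _) , inj₂ (inj₂ (inj₁ (refl , refl))) , cu , _) =
      <⇒≱ (ahead u cu) (≤-pred (≤-trans behind (front-below t b)))
    spread (u@((a' , b') , _) , inj₂ (inj₂ (inj₂ (refl , refl))) , cu , _) =
      <⇒≱ (ahead u cu) (≤-trans (n≤1+n a') (≤-pred (≤-trans behind (front-below t b))))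

  play : ℕ → ℕ → List (Config (T n) (n + 1))
  play t zero    = []
  play t (suc k) = position (suc t) ∷ play (suc t) k

  play-valid : ∀ t k → ValidPlay (T n) (position t) (play t k)
  play-valid t zero    = tt
  play-valid t (suc k) = position-valid t , play-valid (suc t) k

  play-ahead : ∀ t k {C} → Ahead t C → Ahead (k + t) (Contamination (T n) (position t) C (play t k))
  play-ahead t zero    ahead = ahead
  play-ahead t (suc k) {C} ahead =
    subst (λ s → Ahead s (Contamination (T n) (position t) C (play t (suc k))))
      (+-suc k t) (play-ahead (suc t) k (step-ahead t ahead))

  initially-ahead : Ahead 0 (InitialContamination (T n) (position 0))
  initially-ahead v@((a , b) , le) ¬occ = ≤∧≢⇒< (subst (_≤ a) (sym front≡0) z≤n) λ eq →
      ¬occ (proj₁ lion , TVertex-≡ (trans (proj₂ lion 0) (cong (_, b) eq)))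
    where
    lion = lion-in-row b (≤-trans (m≤n+m b a) le)
    front≡0 : front 0 b ≡ 0
    front≡0 = trans (cong (λ x → (n ∸ b) ⊓ ⌊ x /2⌋) (0∸n≡0 b)) (⊓-zeroʳ (n ∸ b))

  -- Every lion starts by turn `n` and then makes at most `n` moves, one every two turns.
  duration : ℕ
  duration = n + (n + n)

  finally-clear : ∀ {C} → Ahead duration C → ∀ v → ¬ C v
  finally-clear ahead v@((a , b) , le) c = <⇒≱ (ahead v c) (begin
    a                        ≤⟨ a≤n∸b ⟩
    n ∸ b                    ≤⟨ ⊓-glb ≤-refl late ⟩
    front duration b         ∎)
    where
    open ≤-Reasoning
    a≤n∸b : a ≤ n ∸ b
    a≤n∸b = subst (_≤ n ∸ b) (m+n∸n≡m a b) (∸-monoˡ-≤ b le)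
    late : n ∸ b ≤ ⌊ duration ∸ b /2⌋
    late = begin
      n ∸ b                  ≤⟨ m∸n≤m n b ⟩
      n                      ≡⟨ n≡⌊n+n/2⌋ n ⟩
      ⌊ n + n /2⌋            ≡⟨ cong ⌊_/2⌋ (sym (m+n∸m≡n n (n + n))) ⟩
      ⌊ duration ∸ n /2⌋     ≤⟨ ⌊n/2⌋-mono (∸-monoʳ-≤ duration (≤-trans (m≤n+m b a) le)) ⟩
      ⌊ duration ∸ b /2⌋     ∎

  lionsWin : LionsWin (T n) (n + 1)
  lionsWin = position 0 , play 0 duration , play-valid 0 duration ,
    finally-clear (subst (λ s → Ahead s final) (+-identityʳ duration) (play-ahead 0 duration initially-ahead))
    where
    final = Contamination (T n) (position 0) (InitialContamination (T n) (position 0)) (play 0 duration)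

-- Isoperimetry in the triangle

⟦_⟧ : Bool → ℕ
⟦ b ⟧ = if b then 1 else 0

⟦⟧≤1 : ∀ b → ⟦ b ⟧ ≤ 1
⟦⟧≤1 true  = ≤-refl
⟦⟧≤1 false = z≤n

⟦⟧-mono : ∀ x y → (IsTrue x → IsTrue y) → ⟦ x ⟧ ≤ ⟦ y ⟧
⟦⟧-mono false y     _ = z≤n
⟦⟧-mono true  true  _ = ≤-refl
⟦⟧-mono true  false f = contradiction (f tt) λ ()

⟦⟧-true : ∀ {b} → IsTrue b → 1 ≤ ⟦ b ⟧
⟦⟧-true {true} _ = ≤-refl

-- Sums over columns and triangles

sumTo : ℕ → (ℕ → ℕ) → ℕ
sumTo zero    f = 0
sumTo (suc L) f = f 0 + sumTo L (f ∘ suc)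

sumTo-mono : ∀ L {f g} → (∀ b → b < L → f b ≤ g b) → sumTo L f ≤ sumTo L g
sumTo-mono zero    _ = z≤n
sumTo-mono (suc L) h = +-mono-≤ (h 0 (s≤s z≤n)) (sumTo-mono L λ b b<L → h (suc b) (s≤s b<L))

sumTo-+ : ∀ L f g → sumTo L (λ b → f b + g b) ≡ sumTo L f + sumTo L g
sumTo-+ zero    f g = refl
sumTo-+ (suc L) f g rewrite sumTo-+ L (f ∘ suc) (g ∘ suc) = interchange (f 0) (g 0) _ _

sumTo-const : ∀ L c → sumTo L (λ _ → c) ≡ L * c
sumTo-const zero    c = refl
sumTo-const (suc L) c = cong (c +_) (sumTo-const L c)

sumTri : ℕ → (ℕ → ℕ → ℕ) → ℕ
sumTri zero    w = 0
sumTri (suc L) w = sumTo (suc L) (w 0) + sumTri L (w ∘ suc)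

sumTri-mono : ∀ L {v w} → (∀ a b → a + b < L → v a b ≤ w a b) → sumTri L v ≤ sumTri L w
sumTri-mono zero    _ = z≤n
sumTri-mono (suc L) h = +-mono-≤ (sumTo-mono (suc L) (h 0)) (sumTri-mono L λ a b lt → h (suc a) b (s≤s lt))

sumTri-+ : ∀ L v w → sumTri L (λ a b → v a b + w a b) ≡ sumTri L v + sumTri L w
sumTri-+ zero    v w = refl
sumTri-+ (suc L) v w
  rewrite sumTo-+ (suc L) (v 0) (w 0) | sumTri-+ L (v ∘ suc) (w ∘ suc) =
  interchange (sumTo (suc L) (v 0)) (sumTo (suc L) (w 0)) _ _

sumTri-zero : ∀ L → sumTri L (λ _ _ → 0) ≡ 0
sumTri-zero zero    = refl
sumTri-zero (suc L) = cong₂ _+_ (trans (sumTo-const (suc L) 0) (*-zeroʳ (suc L))) (sumTri-zero L)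

-- Twice a triangular number, so twice the number of cells in a triangle of side `x`. Sizes are
-- doubled to avoid division.
pronic : ℕ → ℕ
pronic x = x * suc x

pronic-suc : ∀ x → pronic (suc x) ≡ pronic x + 2 * suc x
pronic-suc = expand
  where
  expand : ∀ x → suc x * suc (suc x) ≡ x * suc x + 2 * suc x
  expand = solve-∀

pronic-mono : ∀ {x y} → x ≤ y → pronic x ≤ pronic y
pronic-mono x≤y = *-mono-≤ x≤y (s≤s x≤y)

sumTri-one : ∀ L → 2 * sumTri L (λ _ _ → 1) ≡ pronic L
sumTri-one zero    = refl
sumTri-one (suc L) = begin-equality
  2 * (sumTo (suc L) (λ _ → 1) + sumTri L (λ _ _ → 1))
    ≡⟨ cong (λ x → 2 * (x + sumTri L (λ _ _ → 1))) (trans (sumTo-const (suc L) 1) (*-identityʳ (suc L))) ⟩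
  2 * (suc L + sumTri L (λ _ _ → 1))                        ≡⟨ *-distribˡ-+ 2 (suc L) _ ⟩
  2 * suc L + 2 * sumTri L (λ _ _ → 1)                      ≡⟨ cong (2 * suc L +_) (sumTri-one L) ⟩
  2 * suc L + pronic L                                      ≡⟨ +-comm (2 * suc L) (pronic L) ⟩
  pronic L + 2 * suc L                                      ≡⟨ sym (pronic-suc L) ⟩
  pronic (suc L)                                            ∎
  where open ≤-Reasoning

count : ℕ → (ℕ → Bool) → ℕ
count L f = sumTo L (⟦_⟧ ∘ f)

size : ℕ → (ℕ → ℕ → Bool) → ℕ
size L S = sumTri L (λ a b → ⟦ S a b ⟧)

count-mono : ∀ L {f g} → (∀ b → b < L → IsTrue (f b) → IsTrue (g b)) → count L f ≤ count L g
count-mono L h = sumTo-mono L λ b b<L → ⟦⟧-mono _ _ (h b b<L)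

count≤ : ∀ L f → count L f ≤ L
count≤ L f = ≤-trans (sumTo-mono L (λ b _ → ⟦⟧≤1 (f b)))
  (≤-reflexive (trans (sumTo-const L 1) (*-identityʳ L)))

size≤ : ∀ L S → 2 * size L S ≤ pronic L
size≤ L S = ≤-trans (*-monoʳ-≤ 2 (sumTri-mono L (λ a b _ → ⟦⟧≤1 (S a b)))) (≤-reflexive (sumTri-one L))

size-full : ∀ L S → (∀ a b → a + b < L → IsTrue (S a b)) → pronic L ≤ 2 * size L S
size-full L S all = ≤-trans (≤-reflexive (sym (sumTri-one L)))
  (*-monoʳ-≤ 2 (sumTri-mono L (λ a b lt → ⟦⟧-true (all a b lt))))

-- Here `f` is the next column and `g` the interior of this one. Before the first row missing from
-- `f`, cells of `g` are matched with the same row. The gap excludes both cells of `g` adjacent to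
-- it, and beyond it cells of `g` are matched one row down.
interior≤next : ∀ L f g →
  (∀ b → b < L → IsTrue (g b) → IsTrue (f b)) →
  (∀ b → b < L → IsTrue (g (suc b)) → IsTrue (f b)) →
  count L f ≡ L ⊎ count (suc L) g ≤ count L f
interior≤next zero    f g _ _ = inj₁ refl
interior≤next (suc L) f g same down
  with f 0 | ⟦⟧-mono _ _ (same 0 (s≤s z≤n)) | ⟦⟧-mono _ _ (down 0 (s≤s z≤n))
     | interior≤next L (f ∘ suc) (g ∘ suc) (λ b lt → same (suc b) (s≤s lt)) (λ b lt → down (suc b) (s≤s lt))
... | true  | g0≤ | _   | inj₁ full = inj₁ (cong suc full)
... | true  | g0≤ | _   | inj₂ le   = inj₂ (+-mono-≤ g0≤ le)
... | false | g0≤ | g1≤ | _         =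
  inj₂ (+-mono-≤ g0≤ (+-mono-≤ g1≤ (count-mono L λ b lt → down (suc b) (s≤s lt))))

-- The column `f` contains `g` and its shift by one row, and a nonempty finite set together with its
-- shift has at least one element more than the set.
interior<previous : ∀ L f g →
  (∀ b → b < L → IsTrue (g b) → IsTrue (f b)) →
  (∀ b → b < L → IsTrue (g b) → IsTrue (f (suc b))) →
  (count (suc L) f ≡ 0 × count L g ≡ 0) ⊎ count L g < count (suc L) f
interior<previous zero f g _ _ with f 0
... | true  = inj₂ ≤-refl
... | false = inj₁ (refl , refl)
interior<previous (suc L) f g same up
  with interior<previous L (f ∘ suc) (g ∘ suc) (λ b lt → same (suc b) (s≤s lt)) (λ b lt → up (suc b) (s≤s lt))
... | inj₂ lt = inj₂ (≤-trans (≤-reflexive (sym (+-suc ⟦ g 0 ⟧ _))) (+-mono-≤ (⟦⟧-mono _ _ (same 0 (s≤s z≤n))) lt))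
... | inj₁ (f≡0 , g≡0)
  with f 0 | ≤-trans (⟦⟧-mono (g 0) (f 1) (up 0 (s≤s z≤n))) (≤-reflexive (m+n≡0⇒m≡0 _ f≡0))
...   | false | g0≤0 = inj₁ (f≡0 , cong₂ _+_ (n≤0⇒n≡0 g0≤0) g≡0)
...   | true  | g0≤0 = inj₂ (s≤s (+-mono-≤ g0≤0 (≤-trans (≤-reflexive g≡0) z≤n)))

-- A column neither empty nor full has two consecutive rows of which exactly one lies in `f`, and
-- that one cannot lie in `g`.
interior<column : ∀ L f g →
  (∀ b → b < L → IsTrue (g b) → IsTrue (f b)) →
  (∀ b → suc b < L → IsTrue (g b) → IsTrue (f (suc b))) →
  (∀ b → suc b < L → IsTrue (g (suc b)) → IsTrue (f b)) →
  count L f ≡ 0 ⊎ count L f ≡ L ⊎ count L g < count L f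
interior<column zero f g _ _ _ = inj₁ refl
interior<column (suc zero) f g _ _ _ with f 0
... | true  = inj₂ (inj₁ refl)
... | false = inj₁ refl
interior<column (suc (suc L)) f g same up down
  with interior<column (suc L) (f ∘ suc) (g ∘ suc) (λ b lt → same (suc b) (s≤s lt))
         (λ b lt → up (suc b) (s≤s lt)) (λ b lt → down (suc b) (s≤s lt))
... | inj₂ (inj₂ lt) = inj₂ (inj₂ (≤-trans
        (≤-reflexive (sym (+-suc ⟦ g 0 ⟧ _))) (+-mono-≤ (⟦⟧-mono _ _ (same 0 (s≤s z≤n))) lt)))
... | inj₁ f≡0 with f 0
...   | false = inj₁ f≡0
...   | true  = inj₂ (inj₂ (s≤s (+-mono-≤
        (≤-trans (⟦⟧-mono (g 0) (f 1) (up 0 (s≤s (s≤s z≤n)))) (≤-reflexive (m+n≡0⇒m≡0 _ f≡0)))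
        (count-mono (suc L) (λ b lt → same (suc b) (s≤s lt))))))
interior<column (suc (suc L)) f g same up down | inj₂ (inj₁ full)
  with f 0 | ⟦⟧-mono _ _ (same 0 (s≤s z≤n)) | ⟦⟧-mono _ _ (down 0 (s≤s (s≤s z≤n)))
... | true  | _   | _   = inj₂ (inj₁ (cong suc full))
... | false | g0≤ | g1≤ = inj₂ (inj₂ (≤-trans
        (s≤s (+-mono-≤ g0≤ (+-mono-≤ g1≤ (count≤ L (λ b → g (suc (suc b)))))))
        (≤-reflexive (sym full))))

-- Boundary against size, column by column

record Interior (L : ℕ) (S J : ℕ → ℕ → Bool) : Set where
  field
    inside    : ∀ a b → a + b < L → IsTrue (J a b) → IsTrue (S a b)
    up        : ∀ a b → a + suc b < L → IsTrue (J a b) → IsTrue (S a (suc b))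
    down      : ∀ a b → a + suc b < L → IsTrue (J a (suc b)) → IsTrue (S a b)
    right     : ∀ a b → suc a + b < L → IsTrue (J a b) → IsTrue (S (suc a) b)
    left      : ∀ a b → suc a + b < L → IsTrue (J (suc a) b) → IsTrue (S a b)
    downright : ∀ a b → suc a + b < L → IsTrue (J a (suc b)) → IsTrue (S (suc a) b)
    upleft    : ∀ a b → suc a + b < L → IsTrue (J (suc a) b) → IsTrue (S a (suc b))

Interior-tail : ∀ {L S J} → Interior (suc L) S J → Interior L (S ∘ suc) (J ∘ suc)
Interior-tail int = record
  { inside    = λ a b lt → inside (suc a) b (s≤s lt)
  ; up        = λ a b lt → up (suc a) b (s≤s lt)
  ; down      = λ a b lt → down (suc a) b (s≤s lt)
  ; right     = λ a b lt → right (suc a) b (s≤s lt)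
  ; left      = λ a b lt → left (suc a) b (s≤s lt)
  ; downright = λ a b lt → downright (suc a) b (s≤s lt)
  ; upleft    = λ a b lt → upleft (suc a) b (s≤s lt)
  }
  where open Interior int

-- A triangle of side L holds s cells of S; the first column holds h of them, j of these interior,
-- and C is the number of boundary cells.  Both alternatives hold as soon as C ≥ L, so the induction
-- may switch between them where the next column is full or empty.
Small Large : (L h j s C : ℕ) → Set
Small L h j s C = h ≤ C × 2 * s ≤ pronic C
Large L h j s C = L ≤ C + j × pronic L ≤ 2 * s + pronic C

-- The inductive step as pure arithmetic. The new first column is described by `c`, `h`, `j`, the
-- column next to it by `h₁`, `j₁`, and the whole triangle without the new column by `s₁`, `C`. The
-- hypotheses `F₁`, `F₂`, `F₃` are the three column comparisons.
module AddColumn {L h j c h₁ j₁ s₁ C : ℕ}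
  (h≡ : c + j ≡ h) (h₁≤L : h₁ ≤ L) (s₁≤ : 2 * s₁ ≤ pronic L) (h₁≤ : h₁ ≤ C + j₁)
  (F₁ : h₁ ≡ L ⊎ j ≤ h₁) (F₂ : (h ≡ 0 × j₁ ≡ 0) ⊎ j₁ < h) (F₃ : h ≡ 0 ⊎ h ≡ suc L ⊎ j < h)
  where

  open ≤-Reasoning

  Result : Set
  Result = Small (suc L) h j (h + s₁) (c + C) ⊎ Large (suc L) h j (h + s₁) (c + C)

  j<h⇒1≤c : j < h → 1 ≤ c
  j<h⇒1≤c j<h = +-cancelʳ-≤ j 1 c (≤-trans j<h (≤-reflexive (sym h≡)))

  j<h⇒C<c+C : j < h → suc C ≤ c + C
  j<h⇒C<c+C j<h = +-monoˡ-≤ C (j<h⇒1≤c j<h)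

  empty : h ≡ 0 → j₁ ≡ 0 → Small L h₁ j₁ s₁ C ⊎ Large L h₁ j₁ s₁ C → Result
  empty h≡0 j₁≡0 ih = inj₁
      ( ≤-trans (≤-reflexive h≡0) z≤n
      , ≤-trans (≤-reflexive (cong (λ x → 2 * (x + s₁)) h≡0)) (≤-trans (s-bound ih) (pronic-mono (m≤n+m C c))))
    where
    s-bound : Small L h₁ j₁ s₁ C ⊎ Large L h₁ j₁ s₁ C → 2 * s₁ ≤ pronic C
    s-bound (inj₁ (_ , s≤)) = s≤
    -- With `j₁` zero, `Large` gives `L ≤ C`, and the trivial bound on `s₁` suffices.
    s-bound (inj₂ (L≤ , _)) = ≤-trans s₁≤ (pronic-mono (≤-trans L≤
      (≤-reflexive (trans (cong (C +_) j₁≡0) (+-identityʳ C)))))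

  small : h₁ ≤ C → 2 * s₁ ≤ pronic C → j ≤ h₁ → j < h → Result
  small h₁≤C s≤ j≤h₁ j<h = inj₁ (h≤ , sum (c + C) (j<h⇒C<c+C j<h) h≤)
    where
    h≤ : h ≤ c + C
    h≤ = ≤-trans (≤-reflexive (sym h≡)) (+-monoʳ-≤ c (≤-trans j≤h₁ h₁≤C))
    -- The sum `c + C` is generalised to `x` so that it can be split as a successor. The last
    -- increment of `pronic` pays for the `h` new cells, the rest for `s₁`.
    sum : ∀ x → suc C ≤ x → h ≤ x → 2 * (h + s₁) ≤ pronic x
    sum (suc x) (s≤s C≤x) h≤x = begin
      2 * (h + s₁)              ≡⟨ *-distribˡ-+ 2 h s₁ ⟩
      2 * h + 2 * s₁            ≤⟨ +-mono-≤ (*-monoʳ-≤ 2 h≤x) (≤-trans s≤ (pronic-mono C≤x)) ⟩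
      2 * suc x + pronic x      ≡⟨ +-comm (2 * suc x) (pronic x) ⟩
      pronic x + 2 * suc x      ≡⟨ sym (pronic-suc x) ⟩
      pronic (suc x)            ∎

  -- Passing to side `suc L` costs `2 * suc L`. A full column pays with its own cells. A mixed one
  -- has a boundary cell, so `pronic` gains at least `2 * suc C`, and with `2 * h` this is enough.
  large : suc L ≤ C + h → pronic L ≤ 2 * s₁ + pronic C → h ≡ suc L ⊎ j < h → Result
  large L<C+h pL≤ full-or-mixed = inj₂ (≤-trans L<C+h (≤-reflexive rearrange) , sum full-or-mixed)
    where
    rearrange : C + h ≡ c + C + j
    rearrange = trans (cong (C +_) (sym h≡)) (trans (sym (+-assoc C c j)) (cong (_+ j) (+-comm C c)))
    reorder : ∀ h s p → 2 * s + p + 2 * h ≡ 2 * (h + s) + p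
    reorder = solve-∀
    reorder′ : ∀ h s p x → 2 * s + p + 2 * (x + h) ≡ 2 * (h + s) + (p + 2 * x)
    reorder′ = solve-∀
    sum : h ≡ suc L ⊎ j < h → pronic (suc L) ≤ 2 * (h + s₁) + pronic (c + C)
    sum (inj₁ h≡L) = begin
      pronic (suc L)                         ≡⟨ pronic-suc L ⟩
      pronic L + 2 * suc L                   ≤⟨ +-mono-≤ pL≤ (≤-reflexive (cong (2 *_) (sym h≡L))) ⟩
      2 * s₁ + pronic C + 2 * h              ≡⟨ reorder h s₁ (pronic C) ⟩
      2 * (h + s₁) + pronic C                ≤⟨ +-monoʳ-≤ (2 * (h + s₁)) (pronic-mono (m≤n+m C c)) ⟩
      2 * (h + s₁) + pronic (c + C)          ∎
    sum (inj₂ j<h) = begin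
      pronic (suc L)                         ≡⟨ pronic-suc L ⟩
      pronic L + 2 * suc L                   ≤⟨ +-mono-≤ pL≤ (*-monoʳ-≤ 2 (≤-trans L<C+h (n≤1+n (C + h)))) ⟩
      2 * s₁ + pronic C + 2 * (suc C + h)    ≡⟨ reorder′ h s₁ (pronic C) (suc C) ⟩
      2 * (h + s₁) + (pronic C + 2 * suc C)  ≡⟨ cong (2 * (h + s₁) +_) (sym (pronic-suc C)) ⟩
      2 * (h + s₁) + pronic (suc C)          ≤⟨ +-monoʳ-≤ (2 * (h + s₁)) (pronic-mono (j<h⇒C<c+C j<h)) ⟩
      2 * (h + s₁) + pronic (c + C)          ∎

  nonempty : j₁ < h → h ≡ suc L ⊎ j < h → Small L h₁ j₁ s₁ C ⊎ Large L h₁ j₁ s₁ C → Result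
  nonempty j₁<h full-or-mixed = [ from-small F₁ , from-large ]′
    where
    from-large : Large L h₁ j₁ s₁ C → Result
    from-large (L≤ , pL≤) = large
      (≤-trans (s≤s L≤) (≤-trans (≤-reflexive (sym (+-suc C j₁))) (+-monoʳ-≤ C j₁<h))) pL≤ full-or-mixed
    -- Even a full column has a boundary cell here, since the next column is too short to keep all
    -- of it interior.
    mixed : j ≤ h₁ → h ≡ suc L ⊎ j < h → j < h
    mixed j≤h₁ (inj₁ h≡L) = ≤-trans (s≤s (≤-trans j≤h₁ h₁≤L)) (≤-reflexive (sym h≡L))
    mixed j≤h₁ (inj₂ j<h) = j<h
    from-small : h₁ ≡ L ⊎ j ≤ h₁ → Small L h₁ j₁ s₁ C → Result
    from-small (inj₂ j≤h₁) (h₁≤C , s≤) = small h₁≤C s≤ j≤h₁ (mixed j≤h₁ full-or-mixed)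
    -- A full second column forces `L ≤ C`, the situation in which `Small` can be traded for
    -- `Large`.
    from-small (inj₁ h₁≡L) (h₁≤C , s≤) = from-large
      (subst (_≤ C + j₁) h₁≡L h₁≤ ,
       ≤-trans (pronic-mono (subst (_≤ C) h₁≡L h₁≤C)) (m≤n+m (pronic C) (2 * s₁)))

  result : Small L h₁ j₁ s₁ C ⊎ Large L h₁ j₁ s₁ C → Result
  result ih = cases F₂ F₃
    where
    cases : (h ≡ 0 × j₁ ≡ 0) ⊎ j₁ < h → h ≡ 0 ⊎ h ≡ suc L ⊎ j < h → Result
    cases (inj₁ (h≡0 , j₁≡0)) _           = empty h≡0 j₁≡0 ih
    cases (inj₂ j₁<h)         (inj₂ rest) = nonempty j₁<h rest ih
    cases (inj₂ j₁<h)         (inj₁ h≡0)  = contradiction (subst (j₁ <_) h≡0 j₁<h) λ ()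

-- The bound on the first column and the first halves of `Small` and `Large` strengthen the claim so
-- that the induction over columns goes through. As `pronic L` is twice the number of all cells, the
-- second half of `Large` bounds the complement of `S`.
isoperimetry : ∀ L S J → Interior L S J → ∃ λ C →
  C + size L J ≡ size L S ×
  count L (S 0) ≤ C + count L (J 0) ×
  (Small L (count L (S 0)) (count L (J 0)) (size L S) C ⊎ Large L (count L (S 0)) (count L (J 0)) (size L S) C)
isoperimetry zero    S J int = 0 , refl , z≤n , inj₁ (z≤n , z≤n)
isoperimetry (suc L) S J int with isoperimetry L (S ∘ suc) (J ∘ suc) (Interior-tail int)
... | C , total , h₁≤ , ih = c + C , total′ , h≤ ,
    AddColumn.result {L} {h} {j} {c} {count L (S 1)} {count L (J 1)} {size L (S ∘ suc)} {C}
      h≡ (count≤ L (S 1)) (size≤ L (S ∘ suc)) h₁≤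
      (interior≤next L (S 1) (J 0) (λ b lt → right 0 b (s≤s lt)) (λ b lt → downright 0 b (s≤s lt)))
      (interior<previous L (S 0) (J 1) (λ b lt → left 0 b (s≤s lt)) (λ b lt → upleft 0 b (s≤s lt)))
      (interior<column (suc L) (S 0) (J 0) (inside 0) (up 0) (down 0))
      ih
  where
  open Interior int
  h = count (suc L) (S 0)
  j = count (suc L) (J 0)
  c = h ∸ j
  h≡ : c + j ≡ h
  h≡ = m∸n+n≡m (count-mono (suc L) (inside 0))
  h≤ : h ≤ c + C + j
  h≤ = ≤-trans (≤-reflexive (sym h≡)) (+-monoˡ-≤ j (m≤m+n c C))
  total′ : c + C + (j + size L (J ∘ suc)) ≡ h + size L (S ∘ suc)
  total′ = trans (interchange c C j (size L (J ∘ suc))) (cong₂ _+_ h≡ total)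

-- Few lions cannot win

at : ℕ × ℕ → ℕ → ℕ → ℕ
at (x , y) a b = ⟦ (x ≡ᵇ a) ∧ (y ≡ᵇ b) ⟧

sumTo-at : ∀ L y → sumTo L (λ b → ⟦ y ≡ᵇ b ⟧) ≤ 1
sumTo-at zero    y       = z≤n
sumTo-at (suc L) zero    = s≤s (≤-reflexive (trans (sumTo-const L 0) (*-zeroʳ L)))
sumTo-at (suc L) (suc y) = sumTo-at L y

sumTri-at : ∀ L q → sumTri L (at q) ≤ 1
sumTri-at zero    _           = z≤n
sumTri-at (suc L) (zero  , y) = ≤-trans
  (≤-reflexive (trans (cong (sumTo (suc L) (λ b → ⟦ y ≡ᵇ b ⟧) +_) (sumTri-zero L)) (+-identityʳ _)))
  (sumTo-at (suc L) y)
sumTri-at (suc L) (suc x , y) = ≤-trans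
  (≤-reflexive (cong (_+ sumTri L (at (x , y))) (trans (sumTo-const (suc L) 0) (*-zeroʳ (suc L)))))
  (sumTri-at L (x , y))

at-refl : ∀ a b → 1 ≤ at (a , b) a b
at-refl a b = ⟦⟧-true (Equivalence.from Bool.T-∧ (≡⇒≡ᵇ a a refl , ≡⇒≡ᵇ b b refl))

module Lions (n : ℕ) where

  private
    L = suc n

  -- Counting with multiplicity makes the total additive over the lions and still dominates the
  -- occupied cells.
  lionsAt : ∀ {ℓ} → Config (T n) ℓ → ℕ → ℕ → ℕ
  lionsAt {zero}  p a b = 0
  lionsAt {suc ℓ} p a b = at (proj₁ (p zero)) a b + lionsAt (p ∘ suc) a b

  sumTri-lionsAt : ∀ {ℓ} (p : Config (T n) ℓ) → sumTri L (lionsAt p) ≤ ℓ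
  sumTri-lionsAt {zero}  p = ≤-reflexive (sumTri-zero L)
  sumTri-lionsAt {suc ℓ} p = ≤-trans
    (≤-reflexive (sumTri-+ L (at (proj₁ (p zero))) (lionsAt (p ∘ suc))))
    (+-mono-≤ (sumTri-at L (proj₁ (p zero))) (sumTri-lionsAt (p ∘ suc)))

  occupied⇒lionsAt : ∀ {ℓ} (p : Config (T n) ℓ) {a b le} → Occupied (T n) p ((a , b) , le) → 1 ≤ lionsAt p a b
  occupied⇒lionsAt p {a} {b} (zero  , eq) = ≤-trans
    (subst (λ v → 1 ≤ at (proj₁ v) a b) (sym eq) (at-refl a b)) (m≤m+n _ _)
  occupied⇒lionsAt p (suc i , eq) = ≤-trans (occupied⇒lionsAt (p ∘ suc) (i , eq)) (m≤n+m _ _)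

  -- The sums range over pairs of naturals, so predicates are extended by falsity outside the
  -- triangle.
  AtCell : (TVertex n → Set) → ℕ → ℕ → Set
  AtCell P a b = Σ (a + b ≤ n) λ le → P ((a , b) , le)

  atCell? : ∀ {P} → Decidable P → ∀ a b → Dec (AtCell P a b)
  atCell? {P} P? a b with a + b ≤? n
  ... | yes le = map′ (le ,_) (λ (_ , p) → subst P (TVertex-≡ refl) p) (P? ((a , b) , le))
  ... | no ¬le = no (¬le ∘ proj₁)

  indicator : {P : TVertex n → Set} → Decidable P → ℕ → ℕ → Bool
  indicator P? a b = ⌊ atCell? P? a b ⌋

  indicator⁺ : ∀ {P} (P? : Decidable P) {a b le} → P ((a , b) , le) → IsTrue (indicator P? a b)
  indicator⁺ P? p = fromWitness (_ , p)

  indicator⁻ : ∀ {P} (P? : Decidable P) {a b le} → IsTrue (indicator P? a b) → P ((a , b) , le)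
  indicator⁻ {P} P? t = subst P (TVertex-≡ refl) (proj₂ (toWitness t))

  Clear : (TVertex n → Set) → TVertex n → Set
  Clear C v = ¬ C v

  clear? : ∀ {C} → Decidable C → Decidable (Clear C)
  clear? C? v = ¬? (C? v)

  Safe : (TVertex n → Set) → TVertex n → Set
  Safe C v = ¬ C v × (∀ u → TEdge u v ⊎ TEdge v u → ¬ C u)

  safe? : ∀ {C} → Decidable C → Decidable (Safe C)
  safe? C? v = ¬? (C? v) ×-dec ∀? λ u → (TEdge? u v ⊎-dec TEdge? v u) →-dec ¬? (C? u)

  clearSize safeSize : ∀ {C} → Decidable C → ℕ
  clearSize C? = size L (indicator (clear? C?))
  safeSize C?  = size L (indicator (safe? C?))

  safe-interior : ∀ {C} (C? : Decidable C) → Interior L (indicator (clear? C?)) (indicator (safe? C?))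
  safe-interior {C} C? = record
    { inside    = λ a b lt s → indicator⁺ (clear? C?) {le = s≤s⁻¹ lt} (proj₁ (indicator⁻ (safe? C?) s))
    ; up        = λ a b lt → neighbour (<-pred-column a b lt) lt (inj₂ (inj₂ (inj₁ (refl , refl))))
    ; down      = λ a b lt → neighbour lt (<-pred-column a b lt) (inj₁ (inj₂ (inj₁ (refl , refl))))
    ; right     = λ a b lt → neighbour (<⇒≤ lt) lt (inj₂ (inj₁ (refl , refl)))
    ; left      = λ a b lt → neighbour lt (<⇒≤ lt) (inj₁ (inj₁ (refl , refl)))
    ; downright = λ a b lt → neighbour (shear a b lt) lt (inj₁ (inj₂ (inj₂ (refl , refl))))
    ; upleft    = λ a b lt → neighbour lt (shear a b lt) (inj₂ (inj₂ (inj₂ (refl , refl))))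
    }
    where
    <-pred-column : ∀ a b → a + suc b < L → a + b < L
    <-pred-column a b = ≤-trans (s≤s (+-monoʳ-≤ a (n≤1+n b)))
    shear : ∀ a b → suc a + b < L → a + suc b < L
    shear a b = subst (_< L) (sym (+-suc a b))
    neighbour : ∀ {a b c d} (lt : a + b < L) (lt′ : c + d < L) →
      TEdge {n} ((c , d) , s≤s⁻¹ lt′) ((a , b) , s≤s⁻¹ lt) ⊎ TEdge {n} ((a , b) , s≤s⁻¹ lt) ((c , d) , s≤s⁻¹ lt′) →
      IsTrue (indicator (safe? C?) a b) → IsTrue (indicator (clear? C?) c d)
    neighbour lt lt′ adj s = indicator⁺ (clear? C?) {le = s≤s⁻¹ lt′}
      (proj₂ (indicator⁻ (safe? C?) {le = s≤s⁻¹ lt} s) _ adj)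

  weigh : ∀ {P Q : TVertex n → Set} (P? : Decidable P) (Q? : Decidable Q) w →
    (∀ a b le → P ((a , b) , le) → Q ((a , b) , le) ⊎ 1 ≤ w a b) →
    size L (indicator P?) ≤ size L (indicator Q?) + sumTri L w
  weigh P? Q? w cover = ≤-trans (sumTri-mono L cell) (≤-reflexive (sumTri-+ L (λ a b → ⟦ indicator Q? a b ⟧) w))
    where
    cell : ∀ a b → a + b < L → ⟦ indicator P? a b ⟧ ≤ ⟦ indicator Q? a b ⟧ + w a b
    cell a b (s≤s le) with P? ((a , b) , le)
    ... | no ¬p = ≤-trans (⟦⟧-mono _ (indicator Q? a b) (λ t → contradiction (indicator⁻ P? t) ¬p)) (m≤m+n _ _)
    ... | yes p with cover a b le p
    ...   | inj₁ q   = ≤-trans (⟦⟧-mono _ _ λ _ → indicator⁺ Q? q) (m≤m+n _ _)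
    ...   | inj₂ 1≤w = ≤-trans (⟦⟧≤1 _) (≤-trans 1≤w (m≤n+m _ _))

  module _ {ℓ : ℕ} (p p' : Config (T n) ℓ) {C : TVertex n → Set} (C? : Decidable C) where

    -- A lion traversing an edge at a vertex stands on that vertex before or after the turn. An
    -- untouched vertex therefore has all its edges open, and any contaminated neighbour would
    -- infect it.
    clear-step-safe : clearSize (step? p p' C?) ≤ safeSize C? + (ℓ + ℓ)
    clear-step-safe = ≤-trans
      (weigh (clear? (step? p p' C?)) (safe? C?) (λ a b → lionsAt p a b + lionsAt p' a b) cover)
      (+-monoʳ-≤ (safeSize C?) (≤-trans (≤-reflexive (sumTri-+ L (lionsAt p) (lionsAt p')))
        (+-mono-≤ (sumTri-lionsAt p) (sumTri-lionsAt p'))))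
      where
      cover : ∀ a b le → ¬ Step (T n) p p' C ((a , b) , le) →
        Safe C ((a , b) , le) ⊎ 1 ≤ lionsAt p a b + lionsAt p' a b
      cover a b le ¬step with occupied? p ((a , b) , le) | occupied? p' ((a , b) , le)
      ... | yes occ | _        = inj₂ (≤-trans (occupied⇒lionsAt p occ) (m≤m+n _ _))
      ... | no ¬occ | yes occ′ = inj₂ (≤-trans (occupied⇒lionsAt p' occ′) (m≤n+m _ _))
      ... | no ¬occ | no ¬occ′ = inj₁
        ( (λ c → ¬step (¬occ′ , inj₁ c))
        , λ u adj c → ¬step (¬occ′ , inj₂ (u , adj , c , λ where
            (i , inj₁ (_ , eq)) → ¬occ′ (i , eq)
            (i , inj₂ (eq , _)) → ¬occ (i , eq))))

    -- Contamination stays where it is unless a lion ends its turn there, so each lion clears at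
    -- most one vertex.
    clear-step : clearSize (step? p p' C?) ≤ clearSize C? + ℓ
    clear-step = ≤-trans
      (weigh (clear? (step? p p' C?)) (clear? C?) (lionsAt p') cover)
      (+-monoʳ-≤ (clearSize C?) (sumTri-lionsAt p'))
      where
      cover : ∀ a b le → ¬ Step (T n) p p' C ((a , b) , le) → ¬ C ((a , b) , le) ⊎ 1 ≤ lionsAt p' a b
      cover a b le ¬step with occupied? p' ((a , b) , le)
      ... | yes occ = inj₂ (occupied⇒lionsAt p' occ)
      ... | no ¬occ = inj₁ λ c → ¬step (¬occ , inj₁ c)

  clear-initial : ∀ {ℓ} (p : Config (T n) ℓ) → clearSize (initial? p) ≤ ℓ
  clear-initial p = ≤-trans (sumTri-mono L cell) (sumTri-lionsAt p)
    where
    cell : ∀ a b → a + b < L → ⟦ indicator (clear? (initial? p)) a b ⟧ ≤ lionsAt p a b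
    cell a b (s≤s le) with occupied? p ((a , b) , le)
    ... | yes occ = ≤-trans (⟦⟧≤1 _) (occupied⇒lionsAt p occ)
    ... | no ¬occ = ≤-trans (⟦⟧-mono _ false λ t →
            contradiction ¬occ (indicator⁻ (clear? (initial? p)) t)) z≤n

  -- The clear set stays below the threshold

  module _ {ℓ : ℕ} (few : 8 * (ℓ * ℓ) ≤ n * n) where

    open ≤-Reasoning

    private
      m = ℓ + ℓ

    double-square : 2 * (m * m) ≡ 8 * (ℓ * ℓ)
    double-square = expand ℓ
      where
      expand : ∀ x → 2 * ((x + x) * (x + x)) ≡ 8 * (x * x)
      expand = solve-∀

    -- The left side is `(n + 1) * (n + 2)`, which exceeds `n * n`, while `few` bounds the right
    -- side by `n * n`.
    too-few : ¬ (pronic L ≤ m * m + m * m)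
    too-few le = <⇒≱ {n * n} {pronic L} (*-mono-< (n<1+n n) (≤-trans (n<1+n n) (n≤1+n L))) (begin
      pronic L         ≤⟨ le ⟩
      m * m + m * m    ≡⟨ cong (m * m +_) (sym (+-identityʳ (m * m))) ⟩
      2 * (m * m)      ≡⟨ double-square ⟩
      8 * (ℓ * ℓ)      ≤⟨ few ⟩
      n * n            ∎)

    -- Either the boundary has at least m = 2ℓ vertices and the
    -- clear set cannot grow, or the clear set is so small that even ℓ additional vertices stay below the threshold.
    stays-small : ∀ {s j s′} C → C + j ≡ s → s′ ≤ j + m → s′ ≤ s + ℓ →
      2 * s ≤ m * m → 2 * s ≤ pronic C ⊎ pronic L ≤ 2 * s + pronic C → 2 * s′ ≤ m * m
    stays-small {s} {j} {s′} C C+j≡s s′≤j+m s′≤s+ℓ s≤ iso with m ≤? C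
    ... | yes m≤C = ≤-trans (*-monoʳ-≤ 2 s′≤s) s≤
      where
      s′≤s : s′ ≤ s
      s′≤s = begin
        s′       ≤⟨ s′≤j+m ⟩
        j + m    ≤⟨ +-monoʳ-≤ j m≤C ⟩
        j + C    ≡⟨ +-comm j C ⟩
        C + j    ≡⟨ C+j≡s ⟩
        s        ∎
    -- A clear set with small complement is ruled out: `2 * s` and `pronic C` are both at most
    -- `m * m`, contradicting `too-few`.
    ... | no m≰C = [ small , (λ large → contradiction (≤-trans large (+-mono-≤ s≤ pronic≤)) too-few) ]′ iso
      where
      C<m : C < m
      C<m = ≰⇒> m≰C
      pronic≤ : pronic C ≤ m * m
      pronic≤ = *-mono-≤ (<⇒≤ C<m) C<m
      small : 2 * s ≤ pronic C → 2 * s′ ≤ m * m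
      -- The `ℓ` new vertices add `2 * ℓ`, which is `m`, to at most `C * m`, and `suc C ≤ m`.
      small s≤C = begin
        2 * s′           ≤⟨ *-monoʳ-≤ 2 s′≤s+ℓ ⟩
        2 * (s + ℓ)      ≡⟨ *-distribˡ-+ 2 s ℓ ⟩
        2 * s + 2 * ℓ    ≤⟨ +-mono-≤ (≤-trans s≤C (*-monoʳ-≤ C C<m)) (≤-reflexive (cong (ℓ +_) (+-identityʳ ℓ))) ⟩
        C * m + m        ≡⟨ +-comm (C * m) m ⟩
        suc C * m        ≤⟨ *-monoˡ-≤ m C<m ⟩
        m * m            ∎

    -- The threshold on the clear set is preserved turn by turn, and a fully cleared triangle would
    -- exceed it.
    never-clear : ∀ moves (p : Config (T n) ℓ) {C} (C? : Decidable C) → 2 * clearSize C? ≤ m * m →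
      ¬ (∀ v → ¬ Contamination (T n) p C moves v)
    never-clear [] p C? s≤ clear = too-few (≤-trans
      (size-full L (indicator (clear? C?)) λ a b lt → indicator⁺ (clear? C?) {le = s≤s⁻¹ lt} (clear _))
      (≤-trans s≤ (m≤m+n _ _)))
    never-clear (p' ∷ moves) p C? s≤ =
      let C , total , _ , iso = isoperimetry L (indicator (clear? C?)) (indicator (safe? C?)) (safe-interior C?)
      in never-clear moves p' (step? p p' C?)
           (stays-small C total (clear-step-safe p p' C?) (clear-step p p' C?) s≤
             ([ inj₁ ∘ proj₂ , inj₂ ∘ proj₂ ]′ iso))

    lionsLose : ¬ LionsWin (T n) ℓ
    lionsLose (p , moves , _ , clear) = never-clear moves p (initial? p) (begin
      2 * clearSize (initial? p)   ≤⟨ *-monoʳ-≤ 2 (clear-initial p) ⟩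
      2 * ℓ                        ≡⟨ cong (ℓ +_) (+-identityʳ ℓ) ⟩
      m                            ≤⟨ m≤m*m m ⟩
      m * m                        ∎) clear
      where
      m≤m*m : ∀ x → x ≤ x * x
      m≤m*m zero    = z≤n
      m≤m*m (suc x) = m≤m*n (suc x) (suc x)

-- The lower bound is squared to stay within the naturals: `n * n < 8 * (k * k)` expresses that `n`
-- divided by twice the square root of 2 is less than `k`.
theorem3 : (n : ℕ) → 1 ≤ n →
    ∃ λ k → IsLionNumber (T n) k × (n * n < 8 * (k * k)) × (k ≤ n + 1)
theorem3 n _ =
  let k , win , minimal , k≤n+1 = least lionsWin? (n + 1) (Sweep.lionsWin n)
  in k , (win , minimal) , ≰⇒> (λ few → Lions.lionsLose n few win) , k≤n+1
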